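{- Let $x$ be a hypergame. Then either there exists a winning strategy on $x$ for exactly one of the players L, R, I, II, and there are no non-losing strategies on $x$ for the other players; or at least two of L, R, I, II have a non-losing strategy on $x$. In this latter case, either (i) or (ii) holds: (i) either L or R (but not both) has a non-losing strategy, and either I or II (but not both) has a non-losing strategy; (ii) all the players L, R, I, II have a non-losing strategy.
   Context: Hypergames: work in a universe of possibly non-wellfounded sets (set theory with the Antifoundation Axiom, and the Axiom of Choice). The class $\mathcal H$ of hypergames (also called games) is the carrier of the final coalgebra $(\mathcal H,\mathrm{id})$ of the functor $F(A)=\mathcal P(A)\times\mathcal P(A)$ on the category of classes and functional classes, where $\mathcal P$ is the powerset functor. Thus a hypergame is a pair $x=(X^L,X^R)$ of sets of hypergames; elements $x^L\in X^L$ and $x^R\in X^R$ are the Left and Right options of $x$. Positions of $x$ are the hypergames hereditarily reachable from $x$. Plays: L (Left) and R (Right) move alternately; either may start. Player I is the one who starts, player II the other one; LI means L acting as player I, and similarly LII, RI, RII. A play on $x$ is a (possibly empty) finite or infinite sequence $x_1^{K_1}x_2^{K_2}\cdots$ with $K_i\in\{L,R\}$ and $K_{i+1}\neq K_i$, such that, with $x_0=x$ and $x_i=(X_i^L,X_i^R)$, one has $x_{i+1}\in X_i^{K_{i+1}}$ for all $i\ge 0$. A finite play is winning for L (resp. R) if it ends with a position $y=(Y^L,Y^R)$ where R (resp. L) is next to move but $Y^R=\emptyset$ (resp. $Y^L=\emptyset$); the empty play ends at $x$ with the starting player next to move. Every infinite play is a draw. A play is non-losing for L (resp. R) if it is winning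 for L (resp. R) or is a draw. Strategies: for P in $\{$LI, LII, RI, RII$\}$ let $\mathrm{FPlay}^P_x$ be the set of finite plays on $x$ in which P has the prescribed role (first or second player) and is next to move (the empty play is included exactly when P is LI or RI). A strategy for P on $x$ is a partial function $f$ from $\mathrm{FPlay}^P_x$ to positions of $x$ such that $f(\pi)=x'$ implies that $\pi x'$ is a play, and $f(\pi)$ is defined whenever some $\pi x'$ is a play. The opponent of LI is RII, and of LII is RI (and conversely). A play $\pi$ is coherent with $f$ if for each proper prefix $\pi'$ of $\pi$ where P is next to move, $f(\pi')=x'$ implies $\pi'x'$ is a prefix of $\pi$. For a strategy $f$ for P and a strategy $f'$ for the opponent, $f*f'$ is the unique maximal play coherent with both. $f$ is non-losing (winning) for P if $f*f'$ is non-losing (winning) for P (i.e. for L or R accordingly) for every strategy $f'$ of the opponent. A strategy for L is a pair of strategies for LI and LII; for R, for RI and RII; for I, for LI and RI; for II, for LII and RII. Such a pair is non-losing (winning) if both components are. -}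

module Defs where

open import Data.Maybe.Base using (Maybe; just)
open import Data.Maybe.Relation.Binary.Pointwise using (Pointwise)
open import Data.Nat.Base using (ℕ; zero; suc)
open import Data.Product.Base using (Σ; ∃; _×_; _,_; proj₁; proj₂)
open import Data.Sum.Base using (_⊎_)
open import Function.Bundles using (Func)
open import Level using (Level; _⊔_) renaming (suc to lsuc)
open import Relation.Binary.Bundles using (Setoid)
open import Relation.Binary.Core using (Rel; REL; _Preserves_⟶_)
open import Relation.Binary.PropositionalEquality.Core using (_≡_; refl; _≢_)
open import Relation.Binary.Structures using (IsEquivalence)
open import Relation.Nullary.Negation.Core using (¬_)
open import Relation.Unary using (Pred)

private
  variable
    ℓ a b r : Level

-- The axiom of choice, sets being setoids: a total relation between sets
-- contains (the graph of) a function between sets, i.e. a map that respects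
-- the equalities.
AxiomOfChoice : (ℓ : Level) → Set (lsuc ℓ)
AxiomOfChoice ℓ =
  (A B : Setoid ℓ ℓ) →
  let module A = Setoid A
      module B = Setoid B
  in
  (R : REL A.Carrier B.Carrier ℓ) →
  (∀ {x x′ y y′} → x A.≈ x′ → y B.≈ y′ → R x y → R x′ y′) →
  (∀ x → ∃ (R x)) →
  Σ (Func A B) λ f → ∀ x → R x (Func.to f x)

data Side : Set where
  Left Right : Side

opposite : Side → Side
opposite Left  = Right
opposite Right = Left

-- A coalgebra Node → P(Node) × P(Node) on a set.
record Graph (ℓ : Level) : Set (lsuc ℓ) where
  field
    Node : Set ℓ
    edge : Side → Node → Pred Node ℓ

-- A hypergame is given by a pointed graph: under antifoundation a graph has
-- exactly one decoration by hypergames, and every hypergame decorates the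
-- point of some graph.  Two pointed graphs denote the same hypergame iff they
-- are bisimilar, so equality of hypergames is _≈_ throughout.  That the
-- resulting setoid is the final coalgebra is proved below (module Finality).
record Hypergame (ℓ : Level) : Set (lsuc ℓ) where
  field
    graph : Graph ℓ

  open Graph graph public

  field
    root : Node

open Hypergame

infixl 8 _at_

_at_ : (x : Hypergame ℓ) → Node x → Hypergame ℓ
x at n = record { graph = graph x ; root = n }

record IsBisimulation (G H : Graph ℓ) (R : REL (Graph.Node G) (Graph.Node H) ℓ) : Set ℓ where
  private
    module G = Graph G
    module H = Graph H

  field
    forth : ∀ {k u v u′} → R u v → G.edge k u u′ → ∃ λ v′ → H.edge k v v′ × R u′ v′
    back  : ∀ {k u v v′} → R u v → H.edge k v v′ → ∃ λ u′ → G.edge k u u′ × R u′ v′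

open IsBisimulation

infix 4 _≈_ _∈⟨_⟩_

_≈_ : Rel (Hypergame ℓ) (lsuc ℓ)
_≈_ {ℓ} x y = Σ (REL (Node x) (Node y) ℓ) λ R → IsBisimulation (graph x) (graph y) R × R (root x) (root y)

-- y ∈⟨ Left ⟩ x means y ∈ X^L, and y ∈⟨ Right ⟩ x means y ∈ X^R.
_∈⟨_⟩_ : Hypergame ℓ → Side → Hypergame ℓ → Set (lsuc ℓ)
y ∈⟨ k ⟩ x = ∃ λ n → edge x k (root x) n × y ≈ x at n

≈-refl : {x : Hypergame ℓ} → x ≈ x
≈-refl = _≡_ , record { forth = λ { refl e → _ , e , refl } ; back = λ { refl e → _ , e , refl } } , refl

≈-sym : {x y : Hypergame ℓ} → x ≈ y → y ≈ x
≈-sym (R , bis , r₀) = (λ v u → R u v) , record { forth = back bis ; back = forth bis } , r₀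

≈-trans : {x y z : Hypergame ℓ} → x ≈ y → y ≈ z → x ≈ z
≈-trans {x = x} {z = z} (R , bisR , r₀) (S , bisS , s₀) =
  (λ u w → ∃ λ v → R u v × S v w) , record { forth = fo ; back = ba } , _ , r₀ , s₀
  where
  fo : ∀ {k u w u′} → (∃ λ v → R u v × S v w) → edge x k u u′ →
       ∃ λ w′ → edge z k w w′ × (∃ λ v → R u′ v × S v w′)
  fo (_ , rr , ss) e with forth bisR rr e
  ... | _ , e′ , rr′ with forth bisS ss e′
  ...   | _ , e″ , ss′ = _ , e″ , _ , rr′ , ss′

  ba : ∀ {k u w w′} → (∃ λ v → R u v × S v w) → edge z k w w′ →
       ∃ λ u′ → edge x k u u′ × (∃ λ v → R u′ v × S v w′)
  ba (_ , rr , ss) e with back bisS ss e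
  ... | _ , e′ , ss′ with back bisR rr e′
  ...   | _ , e″ , rr′ = _ , e″ , _ , rr′ , ss′

hypergameSetoid : (ℓ : Level) → Setoid (lsuc ℓ) (lsuc ℓ)
hypergameSetoid ℓ = record
  { Carrier = Hypergame ℓ
  ; _≈_ = _≈_
  ; isEquivalence = record { refl = ≈-refl ; sym = ≈-sym ; trans = ≈-trans }
  }

option-of : (x : Hypergame ℓ) {k : Side} {n : Node x} → edge x k (root x) n → x at n ∈⟨ k ⟩ x
option-of x e = _ , e , ≈-refl

∈-resp-≈ : ∀ {k} {x x′ y y′ : Hypergame ℓ} → y ≈ y′ → x ≈ x′ → y ∈⟨ k ⟩ x → y′ ∈⟨ k ⟩ x′
∈-resp-≈ y≈y′ (R , bis , r₀) (_ , e , y≈) with forth bis r₀ e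
... | _ , e′ , r′ = _ , e′ , ≈-trans (≈-sym y≈y′) (≈-trans y≈ (R , bis , r′))

-- Any relation between hypergames, however large, that is a bisimulation for
-- the membership relations is contained in equality.
module Coinduction
  {ℓ r : Level}
  (R : Rel (Hypergame ℓ) r)
  (forthR : ∀ {k x y x′} → R x y → x′ ∈⟨ k ⟩ x → ∃ λ y′ → y′ ∈⟨ k ⟩ y × R x′ y′)
  (backR  : ∀ {k x y y′} → R x y → y′ ∈⟨ k ⟩ y → ∃ λ x′ → x′ ∈⟨ k ⟩ x × R x′ y′)
  where

  private
    R⁺ : Rel (Hypergame ℓ) (lsuc ℓ ⊔ r)
    R⁺ x y = ∃ λ x₁ → ∃ λ y₁ → x ≈ x₁ × R x₁ y₁ × y₁ ≈ y

    forth⁺ : ∀ {k x y n} → R⁺ x y → edge x k (root x) n →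
             ∃ λ m → edge y k (root y) m × R⁺ (x at n) (y at m)
    forth⁺ {x = x} (_ , _ , x≈ , rr , ≈y) e
      with forthR rr (∈-resp-≈ ≈-refl x≈ (option-of x e))
    ... | y₂ , y₂∈ , rr′ with ∈-resp-≈ ≈-refl ≈y y₂∈
    ...   | m , e′ , y₂≈ = m , e′ , _ , y₂ , ≈-refl , rr′ , y₂≈

    back⁺ : ∀ {k x y m} → R⁺ x y → edge y k (root y) m →
            ∃ λ n → edge x k (root x) n × R⁺ (x at n) (y at m)
    back⁺ {y = y} (_ , _ , x≈ , rr , ≈y) e
      with backR rr (∈-resp-≈ ≈-refl (≈-sym ≈y) (option-of y e))
    ... | x₂ , x₂∈ , rr′ with ∈-resp-≈ ≈-refl (≈-sym x≈) x₂∈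
    ...   | n , e′ , x₂≈ = n , e′ , x₂ , _ , ≈-sym x₂≈ , rr′ , ≈-refl

    data Matched {x y : Hypergame ℓ} (p : R⁺ x y) : Node x → Node y → Set ℓ where
      here : Matched p (root x) (root y)
      viaˡ : ∀ {k n u v} (e : edge x k (root x) n) →
             Matched (proj₂ (proj₂ (forth⁺ {x = x} {y = y} p e))) u v → Matched p u v
      viaʳ : ∀ {k m u v} (e : edge y k (root y) m) →
             Matched (proj₂ (proj₂ (back⁺ {x = x} {y = y} p e))) u v → Matched p u v

    matched-forth : ∀ {x y} (p : R⁺ x y) {k u v u′} → Matched p u v → edge x k u u′ →
                    ∃ λ v′ → edge y k v v′ × Matched p u′ v′
    matched-forth p here e = _ , proj₁ (proj₂ (forth⁺ p e)) , viaˡ e here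
    matched-forth p (viaˡ d m) e with matched-forth _ m e
    ... | _ , e′ , m′ = _ , e′ , viaˡ d m′
    matched-forth p (viaʳ d m) e with matched-forth _ m e
    ... | _ , e′ , m′ = _ , e′ , viaʳ d m′

    matched-back : ∀ {x y} (p : R⁺ x y) {k u v v′} → Matched p u v → edge y k v v′ →
                   ∃ λ u′ → edge x k u u′ × Matched p u′ v′
    matched-back p here e = _ , proj₁ (proj₂ (back⁺ p e)) , viaʳ e here
    matched-back p (viaˡ d m) e with matched-back _ m e
    ... | _ , e′ , m′ = _ , e′ , viaˡ d m′
    matched-back p (viaʳ d m) e with matched-back _ m e
    ... | _ , e′ , m′ = _ , e′ , viaʳ d m′

  coinduction : ∀ {x y} → R x y → x ≈ y
  coinduction {x} {y} rr = Matched p , record { forth = matched-forth p ; back = matched-back p } , here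
    where
    p : R⁺ x y
    p = x , y , ≈-refl , rr , ≈-refl

-- A coalgebra A → P(A) × P(A) on a class A: each set of successors is the
-- image of a small index type, and the structure map is extensional.
module Finality
  {ℓ a b : Level} {Carrier : Set a} {_≈ᴬ_ : Rel Carrier b}
  (isEquivalence : IsEquivalence _≈ᴬ_)
  (Index : Side → Carrier → Set ℓ)
  (child : ∀ {k c} → Index k c → Carrier)
  (extˡ : ∀ {k c d} → c ≈ᴬ d → (i : Index k c) → ∃ λ (j : Index k d) → child i ≈ᴬ child j)
  (extʳ : ∀ {k c d} → c ≈ᴬ d → (j : Index k d) → ∃ λ (i : Index k c) → child i ≈ᴬ child j)
  where

  record IsHomomorphism (h : Carrier → Hypergame ℓ) : Set (a ⊔ b ⊔ lsuc ℓ) where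
    field
      cong : h Preserves _≈ᴬ_ ⟶ _≈_
      out  : ∀ {k c} (i : Index k c) → h (child i) ∈⟨ k ⟩ h c
      into : ∀ {k c y} → y ∈⟨ k ⟩ h c → ∃ λ (i : Index k c) → y ≈ h (child i)

  private
    data Path (c : Carrier) : Set ℓ where
      []  : Path c
      _∷_ : ∀ {k} (i : Index k c) → Path (child i) → Path c

    data Step (k : Side) {c : Carrier} : Path c → Path c → Set ℓ where
      last : (i : Index k c) → Step k [] (i ∷ [])
      next : ∀ {k′} (i : Index k′ c) {p q} → Step k p q → Step k (i ∷ p) (i ∷ q)

  unfold : Carrier → Hypergame ℓ
  unfold c = record { graph = record { Node = Path c ; edge = λ k p q → Step k p q } ; root = [] }

  private
    subgraph : ∀ {k c} (i : Index k c) → unfold (child i) ≈ unfold c at (i ∷ [])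
    subgraph i = (λ p q → q ≡ i ∷ p)
      , record { forth = λ { refl e → _ , next i e , refl }
               ; back  = λ { refl (next _ e) → _ , e , refl } }
      , refl

    unfold-out : ∀ {k c} (i : Index k c) → unfold (child i) ∈⟨ k ⟩ unfold c
    unfold-out i = i ∷ [] , last i , subgraph i

    unfold-into : ∀ {k c y} → y ∈⟨ k ⟩ unfold c → ∃ λ (i : Index k c) → y ≈ unfold (child i)
    unfold-into (_ , last i , y≈) = i , ≈-trans y≈ (≈-sym (subgraph i))

    module _ (g h : Carrier → Hypergame ℓ)
      (g-out  : ∀ {k c} (i : Index k c) → g (child i) ∈⟨ k ⟩ g c)
      (g-into : ∀ {k c y} → y ∈⟨ k ⟩ g c → ∃ λ (i : Index k c) → y ≈ g (child i))
      (h-out  : ∀ {k c} (i : Index k c) → h (child i) ∈⟨ k ⟩ h c)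
      (h-into : ∀ {k c y} → y ∈⟨ k ⟩ h c → ∃ λ (i : Index k c) → y ≈ h (child i))
      where

      Related : Rel (Hypergame ℓ) (a ⊔ b ⊔ lsuc ℓ)
      Related x y = ∃ λ c → ∃ λ d → c ≈ᴬ d × x ≈ g c × y ≈ h d

      related-forth : ∀ {k x y x′} → Related x y → x′ ∈⟨ k ⟩ x → ∃ λ y′ → y′ ∈⟨ k ⟩ y × Related x′ y′
      related-forth (c , d , c≈d , x≈ , y≈) x′∈ with g-into (∈-resp-≈ ≈-refl x≈ x′∈)
      ... | i , x′≈ with extˡ c≈d i
      ...   | j , i≈j = h (child j) , ∈-resp-≈ ≈-refl (≈-sym y≈) (h-out j) , _ , _ , i≈j , x′≈ , ≈-refl

      related-back : ∀ {k x y y′} → Related x y → y′ ∈⟨ k ⟩ y → ∃ λ x′ → x′ ∈⟨ k ⟩ x × Related x′ y′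
      related-back (c , d , c≈d , x≈ , y≈) y′∈ with h-into (∈-resp-≈ ≈-refl y≈ y′∈)
      ... | j , y′≈ with extʳ c≈d j
      ...   | i , i≈j = g (child i) , ∈-resp-≈ ≈-refl (≈-sym x≈) (g-out i) , _ , _ , i≈j , ≈-refl , y′≈

      agree : ∀ {c d} → c ≈ᴬ d → g c ≈ h d
      agree c≈d = Coinduction.coinduction Related related-forth related-back
                    (_ , _ , c≈d , ≈-refl , ≈-refl)

  unfold-isHomomorphism : IsHomomorphism unfold
  unfold-isHomomorphism = record
    { cong = agree unfold unfold unfold-out unfold-into unfold-out unfold-into
    ; out  = unfold-out
    ; into = unfold-into
    }

  unfold-unique : ∀ {h} → IsHomomorphism h → ∀ c → h c ≈ unfold c
  unfold-unique {h} hom c =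
    agree h unfold out into unfold-out unfold-into (IsEquivalence.refl isEquivalence)
    where open IsHomomorphism hom

-- FinitePlay s x y k: the finite plays on x in which s is the starting
-- player, ending at position y with k next to move.  The tags K₁, K₂, … of a
-- play are determined by s.
data FinitePlay (s : Side) (x : Hypergame ℓ) : Hypergame ℓ → Side → Set (lsuc ℓ) where
  ε   : FinitePlay s x x s
  _▸_ : ∀ {y k y′} → FinitePlay s x y k → y′ ∈⟨ k ⟩ y → FinitePlay s x y′ (opposite k)

infixl 5 _▸_

turn : Side → ℕ → Side
turn s zero    = s
turn s (suc n) = opposite (turn s n)

_followed-by_ : Hypergame ℓ → (ℕ → Hypergame ℓ) → ℕ → Hypergame ℓ
(x followed-by xs) zero    = x
(x followed-by xs) (suc n) = xs n

record InfinitePlay (s : Side) (x : Hypergame ℓ) : Set (lsuc ℓ) where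
  field
    moved : ℕ → Hypergame ℓ
    step  : ∀ n → (x followed-by moved) (suc n) ∈⟨ turn s n ⟩ (x followed-by moved) n

  position : ℕ → Hypergame ℓ
  position = x followed-by moved

  take : ∀ n → FinitePlay s x (position n) (turn s n)
  take zero    = ε
  take (suc n) = take n ▸ step n

open InfinitePlay

data Play (s : Side) (x : Hypergame ℓ) : Set (lsuc ℓ) where
  finite   : ∀ {y k} → FinitePlay s x y k → Play s x
  infinite : InfinitePlay s x → Play s x

module _ {s : Side} {x : Hypergame ℓ} where

  infix 4 _≋_ _≼_ _⊑_ _⊏_

  -- Equality of plays as sequences of positions; membership proofs do not
  -- count.
  data _≋_ : ∀ {y k y′ k′} → FinitePlay s x y k → FinitePlay s x y′ k′ → Set (lsuc ℓ) where
    ε   : ε ≋ ε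
    _▸_ : ∀ {y k z y′ k′ z′} {π : FinitePlay s x y k} {π′ : FinitePlay s x y′ k′}
            {m : z ∈⟨ k ⟩ y} {m′ : z′ ∈⟨ k′ ⟩ y′} →
          π ≋ π′ → z ≈ z′ → π ▸ m ≋ π′ ▸ m′

  data _≼_ : ∀ {y k y′ k′} → FinitePlay s x y k → FinitePlay s x y′ k′ → Set (lsuc ℓ) where
    equal  : ∀ {y k y′ k′} {π : FinitePlay s x y k} {π′ : FinitePlay s x y′ k′} →
             π ≋ π′ → π ≼ π′
    longer : ∀ {y k y′ k′ z′} {π : FinitePlay s x y k} {π′ : FinitePlay s x y′ k′}
               {m′ : z′ ∈⟨ k′ ⟩ y′} →
             π ≼ π′ → π ≼ π′ ▸ m′

  data _⊑_ : Rel (Play s x) (lsuc ℓ) where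
    finite-finite     : ∀ {y k y′ k′} {π : FinitePlay s x y k} {π′ : FinitePlay s x y′ k′} →
                        π ≼ π′ → finite π ⊑ finite π′
    finite-infinite   : ∀ {y k} {π : FinitePlay s x y k} {ρ : InfinitePlay s x} →
                        (∃ λ n → π ≋ take ρ n) → finite π ⊑ infinite ρ
    infinite-infinite : {ρ ρ′ : InfinitePlay s x} →
                        (∀ n → position ρ n ≈ position ρ′ n) → infinite ρ ⊑ infinite ρ′

  _⊏_ : Rel (Play s x) (lsuc ℓ)
  π ⊏ π′ = π ⊑ π′ × ¬ π′ ⊑ π

  data WinningFor (w : Side) : Play s x → Set (lsuc ℓ) where
    stuck : ∀ {y k} (π : FinitePlay s x y k) →
            k ≡ opposite w → (∀ y′ → ¬ y′ ∈⟨ k ⟩ y) → WinningFor w (finite π)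

  data Draw : Play s x → Set (lsuc ℓ) where
    infinite : (ρ : InfinitePlay s x) → Draw (infinite ρ)

  NonLosingFor : Side → Play s x → Set (lsuc ℓ)
  NonLosingFor w π = WinningFor w π ⊎ Draw π

data Order : Set where
  first second : Order

other : Order → Order
other first  = second
other second = first

-- Who starts, and whether one is the starting player or the other one.
record Role : Set where
  constructor _starts-as_
  field
    starter : Side
    order   : Order

open Role

LI LII RI RII : Role
LI  = Left  starts-as first
LII = Right starts-as second
RI  = Right starts-as first
RII = Left  starts-as second

sideOf : Side → Order → Side
sideOf s first  = s
sideOf s second = opposite s

side : Role → Side
side P = sideOf (starter P) (order P)

opponent : Role → Role
opponent P = starter P starts-as other (order P)

-- A partial function is a map into Maybe.  Its values lie among the positions
-- of x by legal; respects makes it a function of the sequence of positions.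
record Strategy (P : Role) (x : Hypergame ℓ) : Set (lsuc ℓ) where
  field
    move     : ∀ {y} → FinitePlay (starter P) x y (side P) → Maybe (Hypergame ℓ)
    respects : ∀ {y y′} {π : FinitePlay (starter P) x y (side P)}
                 {π′ : FinitePlay (starter P) x y′ (side P)} →
               π ≋ π′ → Pointwise _≈_ (move π) (move π′)
    legal    : ∀ {y z} {π : FinitePlay (starter P) x y (side P)} →
               move π ≡ just z → z ∈⟨ side P ⟩ y
    defined  : ∀ {y z} (π : FinitePlay (starter P) x y (side P)) →
               z ∈⟨ side P ⟩ y → ∃ λ z′ → move π ≡ just z′

open Strategy

module _ {P : Role} {x : Hypergame ℓ} where

  Coherent : Strategy P x → Play (starter P) x → Set (lsuc ℓ)
  Coherent f π =
    ∀ {y z} (π′ : FinitePlay (starter P) x y (side P)) → finite π′ ⊏ π →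
    (eq : move f π′ ≡ just z) → finite (π′ ▸ legal f eq) ⊑ π

module _ {P : Role} {x : Hypergame ℓ} where

  -- π is f * f′, which is determined up to equality of plays.
  record IsProduct (f : Strategy P x) (f′ : Strategy (opponent P) x)
                   (π : Play (starter P) x) : Set (lsuc ℓ) where
    field
      coherent  : Coherent f π
      coherent′ : Coherent f′ π
      maximal   : ∀ π′ → Coherent f π′ → Coherent f′ π′ → π ⊑ π′ → π′ ⊑ π

  Winning : Strategy P x → Set (lsuc ℓ)
  Winning f = ∀ f′ → ∃ λ π → IsProduct f f′ π × WinningFor (side P) π

  NonLosing : Strategy P x → Set (lsuc ℓ)
  NonLosing f = ∀ f′ → ∃ λ π → IsProduct f f′ π × NonLosingFor (side P) π

data Player : Set where
  L R I II : Player

roles : Player → Role × Role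
roles L  = LI , LII
roles R  = RI , RII
roles I  = LI , RI
roles II = LII , RII

PlayerStrategy : Player → Hypergame ℓ → Set (lsuc ℓ)
PlayerStrategy p x = Strategy (proj₁ (roles p)) x × Strategy (proj₂ (roles p)) x

HasWinning : Player → Hypergame ℓ → Set (lsuc ℓ)
HasWinning p x = Σ (PlayerStrategy p x) λ (f , g) → Winning f × Winning g

HasNonLosing : Player → Hypergame ℓ → Set (lsuc ℓ)
HasNonLosing p x = Σ (PlayerStrategy p x) λ (f , g) → NonLosing f × NonLosing g

ExactlyOneWins : Hypergame ℓ → Set (lsuc ℓ)
ExactlyOneWins x = ∃ λ p →
  HasWinning p x ×
  (∀ q → HasWinning q x → q ≡ p) ×
  (∀ q → q ≢ p → ¬ HasNonLosing q x)

AtLeastTwoNonLosing : Hypergame ℓ → Set (lsuc ℓ)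
AtLeastTwoNonLosing x = ∃ λ p → ∃ λ q → p ≢ q × HasNonLosing p x × HasNonLosing q x

ExactlyOneOf : Set a → Set b → Set (a ⊔ b)
ExactlyOneOf A B = (A ⊎ B) × ¬ (A × B)

{-# OPTIONS --safe #-}
module Submission where

-- Fix the starting player.  Call a position won for a player w when w can force
-- a win from it in finitely many moves; this is an inductive predicate Wins.
-- If the initial position is won for w, following a derivation of Wins move by
-- move is a winning strategy: each move passes to a smaller derivation, so no
-- play that obeys the strategy is infinite, and one that stops does so with the
-- opponent to move (Guided.strategy-winning).  If it is not won for the
-- opponent of w, then w can always move to another position that is not won
-- for that opponent, and cannot be the one who is stuck at such a position
-- (Evading.strategy-nonLosing).  Hence, for each starting player, one of
-- the two roles has a winning strategy, or both have a non-losing one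
-- (starter-value).  A role cannot have a winning strategy while the opposite
-- role has a non-losing one (winning-excludes-nonLosing), because any two plays
-- that are products of the same strategies end in the same way.
--
-- A player L, R, I or II is a choice of one role for each of the two starting
-- players, and every combination occurs exactly once.  If both starting
-- players give a won role, the player made of these two roles wins and no other
-- player has a non-losing strategy.  If just one does, the two players that
-- contain the won role are the ones with non-losing strategies; one of them is
-- L or R and the other is I or II.  If none does, all four have one.
--
-- Strategies must respect bisimilarity of positions.  The axiom of choice is
-- used once, to select a representative node in each bisimilarity class of
-- nodes of x (representatives); strategies are then computed from the
-- representatives of the positions met so far.  All further choices are
-- made by excluded middle, which returns a fixed witness of each existential
-- statement.

open import Axiom.ExcludedMiddle using (ExcludedMiddle)
open import Data.List.Base using (List; []; _∷_)
open import Data.Maybe.Base using (Maybe; just; nothing)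
import Data.Maybe.Base as Maybe
open import Data.Maybe.Relation.Binary.Pointwise using (Pointwise; just)
import Data.Maybe.Relation.Binary.Pointwise as Pointwise
open import Data.Nat.Base as ℕ using (ℕ; zero; _≤_)
open import Data.Nat.Properties using (1+n≰n; ≤-reflexive; m≤n⇒m≤1+n)
open import Data.Product.Base using (Σ; ∃; _×_; _,_; proj₁; proj₂)
open import Data.Sum.Base as Sum using (_⊎_; inj₁; inj₂)
open import Data.Unit.Polymorphic.Base using (⊤)
open import Function.Base using (_∘_)
open import Function.Bundles using (Func)
open import Induction.WellFounded using (Acc; acc)
open import Level using (Level; suc; Lift; lift; lower)
open import Relation.Binary.Bundles using (Setoid)
open import Relation.Binary.PropositionalEquality
  using (_≡_; _≢_; refl; sym; trans; cong; cong₂; subst; setoid)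
open import Relation.Nullary.Decidable.Core using (yes; no; True; toWitness; fromWitness)
open import Relation.Nullary.Negation.Core using (¬_; contradiction)
open import Defs

open Hypergame
open InfinitePlay
open IsProduct
open Role
open Strategy

private
  variable
    ℓ : Level
    s k k′ k″ w : Side
    P : Role
    x y y′ y″ : Hypergame ℓ

-- Sides and turns

opposite-irreflexive : k ≢ opposite k
opposite-irreflexive {Left} ()
opposite-irreflexive {Right} ()

opposite-involutive : ∀ k → k ≡ opposite (opposite k)
opposite-involutive Left  = refl
opposite-involutive Right = refl

opposite-injective : opposite k ≡ opposite k′ → k ≡ k′
opposite-injective {Left}  {Left}  _ = refl
opposite-injective {Right} {Right} _ = refl

side-opponent : ∀ P → side (opponent P) ≡ opposite (side P)
side-opponent (s starts-as first) = refl
side-opponent (Left starts-as second) = refl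
side-opponent (Right starts-as second) = refl

side≡opposite-opponent : ∀ P → side P ≡ opposite (side (opponent P))
side≡opposite-opponent P =
  trans (opposite-involutive (side P)) (cong opposite (sym (side-opponent P)))

side-or-opponent : ∀ P k → k ≡ side P ⊎ k ≡ side (opponent P)
side-or-opponent (Left  starts-as first)  Left  = inj₁ refl
side-or-opponent (Left  starts-as first)  Right = inj₂ refl
side-or-opponent (Left  starts-as second) Left  = inj₂ refl
side-or-opponent (Left  starts-as second) Right = inj₁ refl
side-or-opponent (Right starts-as first)  Left  = inj₂ refl
side-or-opponent (Right starts-as first)  Right = inj₁ refl
side-or-opponent (Right starts-as second) Left  = inj₁ refl
side-or-opponent (Right starts-as second) Right = inj₂ refl

side≢opponent : ∀ P → side P ≢ side (opponent P)
side≢opponent P eq = opposite-irreflexive (trans eq (side-opponent P))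

-- Equality and prefixes of plays

-- The side k to move at y has no option.
Stuck : Hypergame ℓ → Side → Set (suc ℓ)
Stuck y k = ∀ y′ → ¬ y′ ∈⟨ k ⟩ y

stuck-resp-≈ : y ≈ y′ → Stuck y k → Stuck y′ k
stuck-resp-≈ y≈y′ stk z z∈ = stk z (∈-resp-≈ ≈-refl (≈-sym y≈y′) z∈)

≋-refl : (π : FinitePlay s x y k) → π ≋ π
≋-refl ε       = ε
≋-refl (π ▸ m) = ≋-refl π ▸ ≈-refl

≋-sym : {π : FinitePlay s x y k} {π′ : FinitePlay s x y′ k′} → π ≋ π′ → π′ ≋ π
≋-sym ε       = ε
≋-sym (p ▸ q) = ≋-sym p ▸ ≈-sym q

≋-trans : {π : FinitePlay s x y k} {π′ : FinitePlay s x y′ k′} {π″ : FinitePlay s x y″ k″} →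
          π ≋ π′ → π′ ≋ π″ → π ≋ π″
≋-trans ε       ε         = ε
≋-trans (p ▸ q) (p′ ▸ q′) = ≋-trans p p′ ▸ ≈-trans q q′

≋⇒≈ : {π : FinitePlay s x y k} {π′ : FinitePlay s x y′ k′} → π ≋ π′ → y ≈ y′
≋⇒≈ ε       = ≈-refl
≋⇒≈ (_ ▸ q) = q

≋⇒turn≡ : {π : FinitePlay s x y k} {π′ : FinitePlay s x y′ k′} → π ≋ π′ → k ≡ k′
≋⇒turn≡ ε       = refl
≋⇒turn≡ (p ▸ _) = cong opposite (≋⇒turn≡ p)

stuck-resp-≋ : {π : FinitePlay s x y k} {π′ : FinitePlay s x y′ k′} →
               π ≋ π′ → Stuck y k → Stuck y′ k′
stuck-resp-≋ p stk with ≋⇒turn≡ p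
... | refl = stuck-resp-≈ (≋⇒≈ p) stk

ε≼ : (π : FinitePlay s x y k) → ε ≼ π
ε≼ ε       = equal ε
ε≼ (π ▸ m) = longer (ε≼ π)

ε⊑ : (ϖ : Play s x) → finite ε ⊑ ϖ
ε⊑ (finite π)   = finite-finite (ε≼ π)
ε⊑ (infinite ρ) = finite-infinite (0 , ε)

≼-respˡ-≋ : {π : FinitePlay s x y k} {π′ : FinitePlay s x y′ k′} {π″ : FinitePlay s x y″ k″} →
            π ≋ π′ → π′ ≼ π″ → π ≼ π″
≼-respˡ-≋ p (equal q)  = equal (≋-trans p q)
≼-respˡ-≋ p (longer q) = longer (≼-respˡ-≋ p q)

⊑-respˡ-≋ : {π : FinitePlay s x y k} {π′ : FinitePlay s x y′ k′} {ϖ : Play s x} →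
            π ≋ π′ → finite π′ ⊑ ϖ → finite π ⊑ ϖ
⊑-respˡ-≋ p (finite-finite q)         = finite-finite (≼-respˡ-≋ p q)
⊑-respˡ-≋ p (finite-infinite (n , q)) = finite-infinite (n , ≋-trans p q)

length : FinitePlay s x y k → ℕ
length ε       = 0
length (π ▸ _) = ℕ.suc (length π)

≋⇒length≡ : {π : FinitePlay s x y k} {π′ : FinitePlay s x y′ k′} → π ≋ π′ → length π ≡ length π′
≋⇒length≡ ε       = refl
≋⇒length≡ (p ▸ _) = cong ℕ.suc (≋⇒length≡ p)

≼⇒length≤ : {π : FinitePlay s x y k} {π′ : FinitePlay s x y′ k′} → π ≼ π′ → length π ≤ length π′
≼⇒length≤ (equal p)  = ≤-reflexive (≋⇒length≡ p)
≼⇒length≤ (longer p) = m≤n⇒m≤1+n (≼⇒length≤ p)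

length-take : (ρ : InfinitePlay s x) → ∀ n → length (take ρ n) ≡ n
length-take ρ zero      = refl
length-take ρ (ℕ.suc n) = cong ℕ.suc (length-take ρ n)

-- A play that is stuck has no proper extension.
stuck-≼⇒≋ : {π : FinitePlay s x y k} {π′ : FinitePlay s x y′ k′} → Stuck y k → π ≼ π′ → π ≋ π′
stuck-≼⇒≋ stk (equal p) = p
stuck-≼⇒≋ stk (longer {m′ = m} p) = contradiction m (stuck-resp-≋ (stuck-≼⇒≋ stk p) stk _)

-- The play is infinite, or it stops because no move is possible.
Terminal : Play s x → Set _
Terminal ϖ = ∃ λ w → NonLosingFor w ϖ

terminal-maximal : {ϖ ϖ′ : Play s x} → Terminal ϖ → ϖ ⊑ ϖ′ → ϖ′ ⊑ ϖ
terminal-maximal (_ , inj₁ (stuck π _ stk)) (finite-finite p) =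
  finite-finite (equal (≋-sym (stuck-≼⇒≋ stk p)))
terminal-maximal (_ , inj₁ (stuck π _ stk)) (finite-infinite {ρ = ρ} (n , p)) =
  contradiction (step ρ n) (stuck-resp-≋ p stk _)
terminal-maximal (_ , inj₂ (infinite ρ)) (infinite-infinite p) =
  infinite-infinite (λ n → ≈-sym (p n))

-- Coherent plays

just-values-≈ : {u v : Maybe (Hypergame ℓ)} →
                Pointwise _≈_ u v → u ≡ just y → v ≡ just y′ → y ≈ y′
just-values-≈ (just y≈y′) refl refl = y≈y′

module _ {P : Role} {x : Hypergame ℓ} (f : Strategy P x) where

  -- The continuation of π by y′ is the one that f prescribes, if f prescribes
  -- any; when P is not to move at π the condition is void.
  Agrees : FinitePlay (starter P) x y k → Hypergame ℓ → Set (suc ℓ)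
  Agrees π y′ = ∀ {y₀ z} (π₀ : FinitePlay (starter P) x y₀ (side P)) →
                π₀ ≋ π → move f π₀ ≡ just z → z ≈ y′

  -- Every move of P in the play is the one prescribed by f.  This is a stepwise
  -- form of coherence of a finite play.
  Obeys : FinitePlay (starter P) x y k → Set (suc ℓ)
  Obeys ε                   = ⊤
  Obeys (_▸_ {y′ = y′} π _) = Obeys π × Agrees π y′

  obeys-resp-≋ : {π : FinitePlay (starter P) x y k} {π′ : FinitePlay (starter P) x y′ k′} →
                 π ≋ π′ → Obeys π → Obeys π′
  obeys-resp-≋ ε       _       = _
  obeys-resp-≋ (p ▸ q) (o , a) =
    obeys-resp-≋ p o , λ π₀ p₀ eq → ≈-trans (a π₀ (≋-trans p₀ (≋-sym p)) eq) q

  obeys⇒follows : {π : FinitePlay (starter P) x y k} {m : y′ ∈⟨ k ⟩ y} →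
                  Obeys (π ▸ m) →
                  ∀ {y₀ z} {σ : FinitePlay (starter P) x y₀ (side P)} → σ ≼ π →
                  (eq : move f σ ≡ just z) → (σ ▸ legal f eq) ≼ (π ▸ m)
  obeys⇒follows (o , a) (equal p)  eq = equal (p ▸ a _ p eq)
  obeys⇒follows (o , a) (longer p) eq = longer (obeys⇒follows o p eq)

  obeys⇒coherent : {π : FinitePlay (starter P) x y k} → Obeys π → Coherent f (finite π)
  obeys⇒coherent o σ (finite-finite (equal p) , ⋢) eq =
    contradiction (finite-finite (equal (≋-sym p))) ⋢
  obeys⇒coherent o σ (finite-finite (longer p) , _) eq = finite-finite (obeys⇒follows o p eq)

  obeys⇒coherent∞ : (ρ : InfinitePlay (starter P) x) → (∀ n → Obeys (take ρ n)) →
                    Coherent f (infinite ρ)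
  obeys⇒coherent∞ ρ o σ (finite-infinite (n , p) , _) eq =
    finite-infinite (ℕ.suc n , p ▸ proj₂ (o (ℕ.suc n)) σ p eq)

  agrees-off-turn : {π : FinitePlay (starter P) x y k} → k ≢ side P → Agrees π y′
  agrees-off-turn k≢ π₀ p eq = contradiction (sym (≋⇒turn≡ p)) k≢

  agrees-or-stuck : (π : FinitePlay (starter P) x y (side P)) →
                    (∃ λ y′ → y′ ∈⟨ side P ⟩ y × Agrees π y′) ⊎ Stuck y (side P)
  agrees-or-stuck π with move f π in eq
  ... | just z = inj₁ (z , legal f eq , agrees)
    where
    agrees : Agrees π z
    agrees π₀ p eq₀ = just-values-≈ (respects f p) eq₀ eq
  ... | nothing = inj₂ is-stuck
    where
    is-stuck : Stuck _ _
    is-stuck z z∈ with defined f π z∈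
    ... | _ , eq′ with trans (sym eq) eq′
    ...   | ()

-- The product of two strategies

module _ {P : Role} {x : Hypergame ℓ} (f : Strategy P x) (f′ : Strategy (opponent P) x) where

  -- Both sides obey their strategies.
  Joint : FinitePlay (starter P) x y k → Set (suc ℓ)
  Joint π = Obeys f π × Obeys f′ π

  -- At each position just one side is to move; the condition on the other is void.
  joint-extends-or-stuck :
    (π : FinitePlay (starter P) x y k) → Joint π →
    (∃ λ y′ → Σ (y′ ∈⟨ k ⟩ y) λ m → Joint (π ▸ m)) ⊎ Stuck y k
  joint-extends-or-stuck {k = k} π (o , o′) with side-or-opponent P k
  joint-extends-or-stuck π (o , o′) | inj₁ refl with agrees-or-stuck f π
  ... | inj₁ (y′ , m , a) = inj₁ (y′ , m , (o , a) , o′ , agrees-off-turn f′ (side≢opponent P))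
  ... | inj₂ stk          = inj₂ stk
  joint-extends-or-stuck π (o , o′) | inj₂ refl with agrees-or-stuck f′ π
  ... | inj₁ (y′ , m , a) = inj₁ (y′ , m , (o , agrees-off-turn f (side≢opponent P ∘ sym)) , o′ , a)
  ... | inj₂ stk          = inj₂ stk

  -- A play in which both sides obey their strategies as long as a move exists.
  data Run : Set (suc ℓ) where
    halts : ∀ {y k} (π : FinitePlay (starter P) x y k) → Joint π → Stuck y k → Run
    lasts : (ρ : InfinitePlay (starter P) x) → (∀ n → Joint (take ρ n)) → Run

  module _ (extend : ∀ {y k} (π : FinitePlay (starter P) x y k) → Joint π →
                     ∃ λ y′ → Σ (y′ ∈⟨ k ⟩ y) λ m → Joint (π ▸ m)) where

    private
      stage : ∀ n → ∃ λ y → Σ (FinitePlay (starter P) x y (turn (starter P) n)) Joint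
      successor : ∀ n → let y , π , _ = stage n in
                  ∃ λ y′ → Σ (y′ ∈⟨ turn (starter P) n ⟩ y) λ m → Joint (π ▸ m)

      stage zero      = x , ε , _
      stage (ℕ.suc n) = let y′ , m , j = successor n in y′ , proj₁ (proj₂ (stage n)) ▸ m , j

      successor n = let _ , π , j = stage n in extend π j

      endless : InfinitePlay (starter P) x
      moved endless n          = proj₁ (successor n)
      step endless zero        = proj₁ (proj₂ (successor 0))
      step endless (ℕ.suc n)   = proj₁ (proj₂ (successor (ℕ.suc n)))

      take≋stage : ∀ n → proj₁ (proj₂ (stage n)) ≋ take endless n
      take≋stage zero      = ε
      take≋stage (ℕ.suc n) = take≋stage n ▸ ≈-refl

    -- The plays of the stages form an infinite play; its initial segments equal
    -- the stages only up to ≋, since moves of the infinite play are stored apart.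
    endless-run : Run
    endless-run = lasts endless λ n →
      let _ , _ , o , o′ = stage n in
      obeys-resp-≋ f (take≋stage n) o , obeys-resp-≋ f′ (take≋stage n) o′

  run : ExcludedMiddle (suc ℓ) → Run
  run em with em {∃ λ y → ∃ λ k → Σ (FinitePlay (starter P) x y k) λ π → Joint π × Stuck y k}
  ... | yes (_ , _ , π , j , stk) = halts π j stk
  ... | no  ∄stuck = endless-run extend
    where
    extend : ∀ {y k} (π : FinitePlay (starter P) x y k) → Joint π →
             ∃ λ y′ → Σ (y′ ∈⟨ k ⟩ y) λ m → Joint (π ▸ m)
    extend π j with joint-extends-or-stuck π j
    ... | inj₁ next = next
    ... | inj₂ stk  = contradiction (_ , _ , π , j , stk) ∄stuck

  halts-isProduct : (π : FinitePlay (starter P) x y k) → Joint π → Stuck y k →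
                    IsProduct f f′ (finite π)
  coherent  (halts-isProduct π (o , o′) stk) = obeys⇒coherent f o
  coherent′ (halts-isProduct π (o , o′) stk) = obeys⇒coherent f′ o′
  maximal   (halts-isProduct {k = k} π j stk) _ _ _ =
    terminal-maximal (opposite k , inj₁ (stuck π (opposite-involutive k) stk))

  lasts-isProduct : (ρ : InfinitePlay (starter P) x) → (∀ n → Joint (take ρ n)) →
                    IsProduct f f′ (infinite ρ)
  coherent  (lasts-isProduct ρ j) = obeys⇒coherent∞ f ρ (proj₁ ∘ j)
  coherent′ (lasts-isProduct ρ j) = obeys⇒coherent∞ f′ ρ (proj₂ ∘ j)
  maximal   (lasts-isProduct ρ j) _ _ _ = terminal-maximal (Left , inj₂ (infinite ρ))

  module _ {ϖ : Play (starter P) x}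
           (coh : Coherent f ϖ) (coh′ : Coherent f′ ϖ) (end : Terminal ϖ) where

    -- The product is unique because a terminal play coherent with both strategies
    -- extends every finite play that obeys both.  It cannot end at a proper
    -- prefix π of such a play, being stuck there, so coherence forces its next
    -- move.
    joint-⊑-terminal : (π : FinitePlay (starter P) x y k) → Joint π → finite π ⊑ ϖ
    joint-⊑-terminal ε _ = ε⊑ ϖ
    joint-⊑-terminal (_▸_ {k = k} π m) ((o , a) , o′ , a′) = extended
      where
      π⊑ϖ : finite π ⊑ ϖ
      π⊑ϖ = joint-⊑-terminal π (o , o′)

      π⊏ϖ : finite π ⊏ ϖ
      π⊏ϖ = π⊑ϖ , proper end
        where
        proper : Terminal ϖ → ¬ ϖ ⊑ finite π
        proper (_ , inj₁ (stuck σ _ stk)) (finite-finite p) = stuck-resp-≋ (stuck-≼⇒≋ stk p) stk _ m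
        proper (_ , inj₂ (infinite _)) ()

      extended : finite (π ▸ m) ⊑ ϖ
      extended with side-or-opponent P k
      ... | inj₁ refl = let _ , eq = defined f π m in
        ⊑-respˡ-≋ (≋-refl π ▸ ≈-sym (a π (≋-refl π) eq)) (coh π π⊏ϖ eq)
      ... | inj₂ refl = let _ , eq = defined f′ π m in
        ⊑-respˡ-≋ (≋-refl π ▸ ≈-sym (a′ π (≋-refl π) eq)) (coh′ π π⊏ϖ eq)

  -- Two terminal coherent plays, the first of which is a win, cannot be good for
  -- different sides: both are compared with a run of the strategies.
  product-unique-outcome : {ϖ ϖ′ : Play (starter P) x} → ExcludedMiddle (suc ℓ) →
    Coherent f ϖ → Coherent f′ ϖ → Coherent f ϖ′ → Coherent f′ ϖ′ →
    WinningFor w ϖ → NonLosingFor k ϖ′ → w ≡ k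
  product-unique-outcome {w = w} {k = k} em coh₁ coh₁′ coh₂ coh₂′ win@(stuck σ refl stkσ) nonlosing
    with run em
  -- An infinite run would have a prefix of σ that is longer than σ.
  ... | lasts ρ j
      with joint-⊑-terminal coh₁ coh₁′ (w , inj₁ win)
             (take ρ (ℕ.suc (length σ))) (j (ℕ.suc (length σ)))
  ...   | finite-finite p = contradiction
    (subst (_≤ length σ) (length-take ρ (ℕ.suc (length σ))) (≼⇒length≤ p)) 1+n≰n
  product-unique-outcome em coh₁ coh₁′ coh₂ coh₂′ win@(stuck σ refl stkσ) nonlosing
      | halts π j stk
    with joint-⊑-terminal coh₁ coh₁′ (_ , inj₁ win) π j
       | joint-⊑-terminal coh₂ coh₂′ (_ , nonlosing) π j
       | nonlosing
  ... | finite-finite p | finite-finite q | inj₁ (stuck σ′ k≡ stkσ′) =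
    opposite-injective
      (trans (sym (≋⇒turn≡ (stuck-≼⇒≋ stk p))) (trans (≋⇒turn≡ (stuck-≼⇒≋ stk q)) k≡))
  ... | _ | finite-infinite (n , q) | inj₂ (infinite ρ) =
    contradiction (step ρ n) (stuck-resp-≋ q stk _)

WinningStrategy NonLosingStrategy : Role → Hypergame ℓ → Set (suc ℓ)
WinningStrategy   P x = ∃ λ (f : Strategy P x) → Winning f
NonLosingStrategy P x = ∃ λ (f : Strategy P x) → NonLosing f

winning⇒nonLosing : WinningStrategy P x → NonLosingStrategy P x
winning⇒nonLosing (f , wins) = f , λ f′ →
  let ϖ , isProduct , win = wins f′ in ϖ , isProduct , inj₁ win

winning-excludes-nonLosing :
  ExcludedMiddle (suc ℓ) → {x : Hypergame ℓ} → ∀ P →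
  WinningStrategy P x → ¬ NonLosingStrategy (opponent P) x
winning-excludes-nonLosing em P (f , wins) (f′ , safe) = clash P f wins f′ safe
  where
  -- The two cases make opponent (opponent P) compute to P.
  clash : ∀ P (f : Strategy P _) → Winning f → (f′ : Strategy (opponent P) _) → ¬ NonLosing f′
  clash P@(_ starts-as first) f wins f′ safe =
    let _ , p , win = wins f′ ; _ , q , nonlosing = safe f in
    side≢opponent P (product-unique-outcome f f′ em
      (coherent p) (coherent′ p) (coherent′ q) (coherent q) win nonlosing)
  clash P@(_ starts-as second) f wins f′ safe =
    let _ , p , win = wins f′ ; _ , q , nonlosing = safe f in
    side≢opponent P (product-unique-outcome f f′ em
      (coherent p) (coherent′ p) (coherent′ q) (coherent q) win nonlosing)

module _ {P : Role} {x : Hypergame ℓ} (f : Strategy P x) where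

  -- A play that obeys f can only stop with the opponent of P unable to move.
  BlocksOnlyOpponent : Set (suc ℓ)
  BlocksOnlyOpponent = ∀ {y k} (π : FinitePlay (starter P) x y k) →
                       Obeys f π → Stuck y k → k ≡ opposite (side P)

  nonLosing-if : ExcludedMiddle (suc ℓ) → BlocksOnlyOpponent → NonLosing f
  nonLosing-if em blocks f′ with run f f′ em
  ... | halts π j stk = finite π , halts-isProduct f f′ π j stk ,
                        inj₁ (stuck π (blocks π (proj₁ j) stk) stk)
  ... | lasts ρ j     = infinite ρ , lasts-isProduct f f′ ρ j , inj₂ (infinite ρ)

  winning-if : ExcludedMiddle (suc ℓ) → BlocksOnlyOpponent →
               (∀ ρ → ¬ ∀ n → Obeys f (take ρ n)) → Winning f
  winning-if em blocks ends f′ with run f f′ em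
  ... | halts π j stk = finite π , halts-isProduct f f′ π j stk ,
                        stuck π (blocks π (proj₁ j) stk) stk
  ... | lasts ρ j     = contradiction (proj₁ ∘ j) (ends ρ)

-- Representatives of positions

-- A function selecting one node in each bisimilarity class of nodes of x.
record Representatives (x : Hypergame ℓ) : Set (suc ℓ) where
  field
    rep      : Node x → Node x
    rep-≈    : ∀ u → x at u ≈ x at rep u
    rep-cong : ∀ {u v} → x at u ≈ x at v → rep u ≡ rep v

representatives : ExcludedMiddle (suc ℓ) → AxiomOfChoice ℓ → (x : Hypergame ℓ) → Representatives x
representatives {ℓ} em choice x = record
  { rep      = Func.to (proj₁ chosen)
  ; rep-≈    = λ u → down (proj₂ chosen u)
  ; rep-cong = λ u≈v → Func.cong (proj₁ chosen) (up u≈v)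
  }
  where
  -- Bisimilarity quantifies over relations and so lives one level too high for
  -- the axiom of choice; deciding it gives an equivalent relation of level ℓ.
  _∼_ : Node x → Node x → Set ℓ
  u ∼ v = Lift ℓ (True (em {x at u ≈ x at v}))

  up : ∀ {u v} → x at u ≈ x at v → u ∼ v
  up u≈v = lift (fromWitness u≈v)

  down : ∀ {u v} → u ∼ v → x at u ≈ x at v
  down (lift u≈v) = toWitness u≈v

  nodes : Setoid ℓ ℓ
  nodes = record
    { Carrier = Node x
    ; _≈_ = _∼_
    ; isEquivalence = record
      { refl  = up ≈-refl
      ; sym   = λ u∼v → up (≈-sym (down u∼v))
      ; trans = λ u∼v v∼w → up (≈-trans (down u∼v) (down v∼w))
      }
    }

  chosen : Σ (Func nodes (setoid (Node x))) λ r → ∀ u → u ∼ Func.to r u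
  chosen = choice nodes (setoid (Node x)) _∼_
    (λ { u∼u′ refl u∼v → up (≈-trans (≈-sym (down u∼u′)) (down u∼v)) })
    (λ u → u , up ≈-refl)

module Positions (em : ExcludedMiddle (suc ℓ)) (x : Hypergame ℓ) (reps : Representatives x) where
  open Representatives reps

  infix 4 _⟶⟨_⟩_

  -- v is the representative of an option of u for the side k.
  _⟶⟨_⟩_ : Node x → Side → Node x → Set (suc ℓ)
  u ⟶⟨ k ⟩ v = x at v ∈⟨ k ⟩ x at u × rep v ≡ v

  rep-unique : ∀ {u v} → rep u ≡ u → rep v ≡ v → x at u ≈ x at v → u ≡ v
  rep-unique ru rv u≈v = trans (sym ru) (trans (rep-cong u≈v) rv)

  rep-idem : ∀ u → rep (rep u) ≡ rep u
  rep-idem u = sym (rep-cong (rep-≈ u))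

  option-rep : ∀ {u} → y ≈ x at u → y′ ∈⟨ k ⟩ y → ∃ λ v → u ⟶⟨ k ⟩ v × y′ ≈ x at v
  option-rep y≈u y′∈y with ∈-resp-≈ ≈-refl y≈u y′∈y
  ... | n , e , y′≈n = rep n , ((n , e , ≈-sym (rep-≈ n)) , rep-idem n) , ≈-trans y′≈n (rep-≈ n)

  -- The representative of the last position of a play, which is node below.
  locate : FinitePlay s x y k → ∃ λ v → rep v ≡ v × y ≈ x at v
  locate ε       = rep (root x) , rep-idem (root x) , rep-≈ (root x)
  locate (π ▸ m) = let v , (_ , rv) , y≈v = option-rep (proj₂ (proj₂ (locate π))) m in v , rv , y≈v

  node : FinitePlay s x y k → Node x
  node π = proj₁ (locate π)

  node-rep : (π : FinitePlay s x y k) → rep (node π) ≡ node π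
  node-rep π = proj₁ (proj₂ (locate π))

  node-≈ : (π : FinitePlay s x y k) → y ≈ x at node π
  node-≈ π = proj₂ (proj₂ (locate π))

  node-unique : ∀ (π : FinitePlay s x y k) {v} → rep v ≡ v → y ≈ x at v → node π ≡ v
  node-unique π rv y≈v = rep-unique (node-rep π) rv (≈-trans (≈-sym (node-≈ π)) y≈v)

  node-cong : {π : FinitePlay s x y k} {π′ : FinitePlay s x y′ k′} → π ≋ π′ → node π ≡ node π′
  node-cong {π = π} {π′} p = node-unique π (node-rep π′) (≈-trans (≋⇒≈ p) (node-≈ π′))

  node-step : (π : FinitePlay s x y k) (m : y′ ∈⟨ k ⟩ y) → node π ⟶⟨ k ⟩ node (π ▸ m)
  node-step π m = proj₁ (proj₂ (option-rep (node-≈ π) m))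

  stuck⇒no-option : (π : FinitePlay s x y k) → Stuck y k → ∀ {v} → ¬ node π ⟶⟨ k ⟩ v
  stuck⇒no-option π stk (v∈ , _) = stk _ (∈-resp-≈ ≈-refl (≈-sym (node-≈ π)) v∈)

  -- The representatives of the positions reached by the moves of a play, the
  -- latest first; the starting position is not included.
  History : Set ℓ
  History = List (Node x)

  history : FinitePlay s x y k → History
  history ε       = []
  history (π ▸ m) = node (π ▸ m) ∷ history π

  history-cong : {π : FinitePlay s x y k} {π′ : FinitePlay s x y′ k′} →
                 π ≋ π′ → history π ≡ history π′
  history-cong ε       = refl
  history-cong (_▸_ {m = m} {m′} p q) =
    cong₂ _∷_ (node-cong (_▸_ {m = m} {m′} p q)) (history-cong p)

  -- Strategies given by preferences

  -- P moves to a representative option preferred in view of the history and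
  -- the current position if there is one, and to any option otherwise.
  module Preferring (P : Role) (Prefers : History → Node x → Node x → Set (suc ℓ)) where

    select : History → Node x → Maybe (Node x)
    select h u with em {∃ λ v → u ⟶⟨ side P ⟩ v × Prefers h u v}
    ... | yes (v , _) = just v
    ... | no  _ with em {∃ λ v → u ⟶⟨ side P ⟩ v}
    ...   | yes (v , _) = just v
    ...   | no  _       = nothing

    select-option : ∀ h u {v} → select h u ≡ just v → u ⟶⟨ side P ⟩ v
    select-option h u eq with em {∃ λ v → u ⟶⟨ side P ⟩ v × Prefers h u v}
    select-option h u refl | yes (_ , e , _) = e
    select-option h u eq   | no  _ with em {∃ λ v → u ⟶⟨ side P ⟩ v}
    select-option h u refl | no  _ | yes (_ , e) = e

    select-defined : ∀ h u {v} → u ⟶⟨ side P ⟩ v → ∃ λ v′ → select h u ≡ just v′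
    select-defined h u e with em {∃ λ v → u ⟶⟨ side P ⟩ v × Prefers h u v}
    ... | yes (v , _) = v , refl
    ... | no  _ with em {∃ λ v → u ⟶⟨ side P ⟩ v}
    ...   | yes (v , _) = v , refl
    ...   | no  ∄       = contradiction (_ , e) ∄

    select-preferred : ∀ h u → (∃ λ v → u ⟶⟨ side P ⟩ v × Prefers h u v) →
                       ∃ λ v → select h u ≡ just v × Prefers h u v
    select-preferred h u ∃v with em {∃ λ v → u ⟶⟨ side P ⟩ v × Prefers h u v}
    ... | yes (v , _ , p) = v , refl , p
    ... | no  ∄           = contradiction ∃v ∄

    strategy : Strategy P x
    move strategy π = Maybe.map (x at_) (select (history π) (node π))
    respects strategy {π = π} {π′} p
      rewrite history-cong p | node-cong p = Pointwise.refl ≈-refl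
    legal strategy {π = π} eq with select (history π) (node π) in sel
    legal strategy {π = π} refl | just v =
      ∈-resp-≈ ≈-refl (≈-sym (node-≈ π)) (proj₁ (select-option (history π) (node π) sel))
    defined strategy π z∈y
      with select-defined (history π) (node π) (proj₁ (proj₂ (option-rep (node-≈ π) z∈y)))
    ... | v , eq = x at v , cong (Maybe.map (x at_)) eq

    obeys⇒prefers : (π : FinitePlay (starter P) x y (side P)) (m : y′ ∈⟨ side P ⟩ y) →
      Obeys strategy (π ▸ m) →
      (∃ λ v → node π ⟶⟨ side P ⟩ v × Prefers (history π) (node π) v) →
      Prefers (history π) (node π) (node (π ▸ m))
    obeys⇒prefers π m (_ , agrees) preferable
      with select-preferred (history π) (node π) preferable
    ... | v , eq , p = subst (Prefers _ _) (sym node≡v) p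
      where
      node≡v : node (π ▸ m) ≡ v
      node≡v = node-unique (π ▸ m) (proj₂ (select-option _ _ eq))
        (≈-sym (agrees π (≋-refl π) (cong (Maybe.map (x at_)) eq)))

  -- Won positions

  -- The side w can force a win in finitely many moves from u with k to move.
  -- A position without options where the opponent of w is to move is won by
  -- await, its second premise being void.
  data Wins (w : Side) (u : Node x) (k : Side) : Set (suc ℓ) where
    choose : ∀ {v} → k ≡ w → u ⟶⟨ k ⟩ v → Wins w v (opposite k) → Wins w u k
    await  : k ≡ opposite w → (∀ {v} → u ⟶⟨ k ⟩ v → Wins w v (opposite k)) → Wins w u k

  -- The winning strategy that follows a derivation of Wins.  At each position
  -- the current derivation is a subderivation of the given one, determined by the
  -- history; a move of the opponent selects a premise of await.
  module Guided (P : Role) (won : Wins (side P) (rep (root x)) (starter P)) where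

    -- A won position with a derivation that it is won.
    Claim : Set (suc ℓ)
    Claim = ∃ λ u → ∃ λ k → Wins (side P) u k

    -- The claim after a move to v.  In the case choose, v is ignored, being the
    -- node v′ when the strategy is obeyed.  The last clause is a default value:
    -- it only concerns histories that do not come from obeying plays.
    advance : Node x → Claim → Claim
    advance v (u , k , choose {v′} _ _ d) = v′ , opposite k , d
    advance v (u , k , await eq h) with em {u ⟶⟨ k ⟩ v}
    ... | yes e = v , opposite k , h e
    ... | no  _ = u , k , await eq h

    claim : History → Claim
    claim []      = rep (root x) , starter P , won
    claim (v ∷ h) = advance v (claim h)

    -- Only a claim made by choose, where P is to move, prescribes a move.
    Prescribed : Claim → Node x → Set (suc ℓ)
    Prescribed (_ , _ , choose {v′} _ _ _) v = Lift _ (v ≡ v′)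
    Prescribed (_ , _ , await _ _)         v = ⊤

    open Preferring P (λ h _ → Prescribed (claim h)) public

    infix 4 _◁_

    -- The first claim is an immediate subderivation of the second.
    data _◁_ : Claim → Claim → Set (suc ℓ) where
      chosen  : ∀ {u v k} {eq : k ≡ side P} {e : u ⟶⟨ k ⟩ v} {d : Wins (side P) v (opposite k)} →
                (v , opposite k , d) ◁ (u , k , choose eq e d)
      awaited : ∀ {u v k} {eq : k ≡ opposite (side P)}
                  {h : ∀ {v} → u ⟶⟨ k ⟩ v → Wins (side P) v (opposite k)} (e : u ⟶⟨ k ⟩ v) →
                (v , opposite k , h e) ◁ (u , k , await eq h)

    ◁-wellFounded : ∀ {u k} (d : Wins (side P) u k) → Acc _◁_ (u , k , d)
    ◁-wellFounded (choose _ _ d) = acc λ { chosen → ◁-wellFounded d }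
    ◁-wellFounded (await _ h)    = acc λ { (awaited e) → ◁-wellFounded (h e) }

    -- The claim computed from the history is about the actual position.
    Tracked : FinitePlay (starter P) x y k → Set (suc ℓ)
    Tracked {k = k} π = ∃ λ (d : Wins (side P) (node π) k) → claim (history π) ≡ (node π , k , d)

    tracked-step : (π : FinitePlay (starter P) x y k) (m : y′ ∈⟨ k ⟩ y) → Obeys strategy (π ▸ m) →
                   Tracked π → Tracked (π ▸ m) × claim (history (π ▸ m)) ◁ claim (history π)
    tracked-step π m o (choose {v} refl e d , eq)
      with lower (subst (λ c → Prescribed c (node (π ▸ m))) eq
             (obeys⇒prefers π m o (v , e , subst (λ c → Prescribed c v) (sym eq) (lift refl))))
    ... | refl rewrite eq = (d , refl) , chosen
    tracked-step {k = k} π m o (await k≡ h , eq) rewrite eq with em {node π ⟶⟨ k ⟩ node (π ▸ m)}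
    ... | yes e = (h e , refl) , awaited e
    ... | no ∄  = contradiction (node-step π m) ∄

    obeys⇒tracked : (π : FinitePlay (starter P) x y k) → Obeys strategy π → Tracked π
    obeys⇒tracked ε       _ = won , refl
    obeys⇒tracked (π ▸ m) o = proj₁ (tracked-step π m o (obeys⇒tracked π (proj₁ o)))

    -- The claims along an infinite play that obeys the strategy would form an
    -- infinite descent in subderivations.
    no-infinite : (ρ : InfinitePlay (starter P) x) → ¬ ∀ n → Obeys strategy (take ρ n)
    no-infinite ρ o = descend (◁-wellFounded won) 0 refl
      where
      descend : ∀ {c} → Acc _◁_ c → ∀ n → claim (history (take ρ n)) ≢ c
      descend (acc rs) n refl = descend
        (rs (proj₂ (tracked-step (take ρ n) (step ρ n) (o (ℕ.suc n)) (obeys⇒tracked _ (o n)))))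
        (ℕ.suc n) refl

    blocks : BlocksOnlyOpponent strategy
    blocks π o stk with obeys⇒tracked π o
    ... | choose _ e _ , _ = contradiction e (stuck⇒no-option π stk)
    ... | await k≡ _   , _ = k≡

    strategy-winning : Winning strategy
    strategy-winning = winning-if strategy em blocks no-infinite

  -- The non-losing strategy that moves to positions not won for the opponent.
  module Evading (P : Role) (unwon : ¬ Wins (side (opponent P)) (rep (root x)) (starter P)) where

    open Preferring P (λ _ _ v → ¬ Wins (side (opponent P)) v (opposite (side P))) public

    -- By excluded middle, a position that is not won for the opponent and where
    -- P is to move has an option that is not won for the opponent.
    evades : (π : FinitePlay (starter P) x y k) → Obeys strategy π →
             ¬ Wins (side (opponent P)) (node π) k
    evades ε _ = unwon
    evades (_▸_ {k = k} π m) o with side-or-opponent P k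
    ... | inj₂ refl = λ d → evades π (proj₁ o) (choose refl (node-step π m) d)
    ... | inj₁ refl with em {∃ λ v → node π ⟶⟨ side P ⟩ v ×
                                     ¬ Wins (side (opponent P)) v (opposite (side P))}
    ...   | yes ∃v = obeys⇒prefers π m o ∃v
    ...   | no  ∄v = contradiction (await (side≡opposite-opponent P) all-won) (evades π (proj₁ o))
      where
      all-won : ∀ {v} → node π ⟶⟨ side P ⟩ v → Wins (side (opponent P)) v (opposite (side P))
      all-won {v} e with em {Wins (side (opponent P)) v (opposite (side P))}
      ... | yes d = d
      ... | no ¬d = contradiction (v , e , ¬d) ∄v

    blocks : BlocksOnlyOpponent strategy
    blocks {k = k} π o stk with side-or-opponent P k
    ... | inj₂ refl = side-opponent P
    ... | inj₁ refl = contradiction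
      (await (side≡opposite-opponent P) (λ e → contradiction e (stuck⇒no-option π stk)))
      (evades π o)

    strategy-nonLosing : NonLosing strategy
    strategy-nonLosing = nonLosing-if strategy em blocks

-- Players as pairs of roles

-- Whether the player goes first or second when the given side starts.
orderOf : Player → Side → Order
orderOf L  Left  = first
orderOf L  Right = second
orderOf R  Left  = second
orderOf R  Right = first
orderOf I  _     = first
orderOf II _     = second

-- The player of the first order when Left starts, of the second when Right starts.
playerWith : Order → Order → Player
playerWith first  first  = I
playerWith first  second = L
playerWith second first  = R
playerWith second second = II

playerWith-orderOf : ∀ p → playerWith (orderOf p Left) (orderOf p Right) ≡ p
playerWith-orderOf L  = refl
playerWith-orderOf R  = refl
playerWith-orderOf I  = refl
playerWith-orderOf II = refl

orderOf-playerWith : (Q : Side → Order → Set ℓ) → ∀ o o′ → Q Left o → Q Right o′ →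
                     ∀ s → Q s (orderOf (playerWith o o′) s)
orderOf-playerWith Q first  first  l r Left  = l
orderOf-playerWith Q first  first  l r Right = r
orderOf-playerWith Q first  second l r Left  = l
orderOf-playerWith Q first  second l r Right = r
orderOf-playerWith Q second first  l r Left  = l
orderOf-playerWith Q second first  l r Right = r
orderOf-playerWith Q second second l r Left  = l
orderOf-playerWith Q second second l r Right = r

module _ {x : Hypergame ℓ} (Q : ∀ {P} → Strategy P x → Set (suc ℓ)) where

  -- The common form of HasWinning and HasNonLosing.
  HasGood : Player → Set (suc ℓ)
  HasGood p = Σ (PlayerStrategy p x) λ (f , g) → Q f × Q g

  -- One good strategy for each of the two roles, indexed by the starting side.
  Components : Player → Set (suc ℓ)
  Components p = ∀ s → ∃ λ (f : Strategy (s starts-as orderOf p s) x) → Q f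

  assemble : ∀ p → Components p → HasGood p
  assemble L  c = let f , qf = c Left  ; g , qg = c Right in (f , g) , qf , qg
  assemble R  c = let f , qf = c Right ; g , qg = c Left  in (f , g) , qf , qg
  assemble I  c = let f , qf = c Left  ; g , qg = c Right in (f , g) , qf , qg
  assemble II c = let f , qf = c Right ; g , qg = c Left  in (f , g) , qf , qg

  components : ∀ p → HasGood p → Components p
  components L  ((f , g) , qf , qg) = λ { Left → f , qf ; Right → g , qg }
  components R  ((f , g) , qf , qg) = λ { Left → g , qg ; Right → f , qf }
  components I  ((f , g) , qf , qg) = λ { Left → f , qf ; Right → g , qg }
  components II ((f , g) , qf , qg) = λ { Left → g , qg ; Right → f , qf }

module Table (em : ExcludedMiddle (suc ℓ)) (choice : AxiomOfChoice ℓ) (x : Hypergame ℓ) where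

  open Positions em x (representatives em choice x)
  open Representatives (representatives em choice x)

  starter-value : ∀ s → (∃ λ o → WinningStrategy (s starts-as o) x) ⊎
                        (∀ o → NonLosingStrategy (s starts-as o) x)
  starter-value s
    with em {Wins (side (s starts-as first)) (rep (root x)) s}
       | em {Wins (side (s starts-as second)) (rep (root x)) s}
  ... | yes d | _     = inj₁ (first , _ , Guided.strategy-winning (s starts-as first) d)
  ... | no _  | yes d = inj₁ (second , _ , Guided.strategy-winning (s starts-as second) d)
  ... | no ¬d | no ¬e = inj₂ λ
    { first  → _ , Evading.strategy-nonLosing (s starts-as first) ¬e
    ; second → _ , Evading.strategy-nonLosing (s starts-as second) ¬d
    }

  nonLosing-order≡winning-order : ∀ {s} o o′ →
    WinningStrategy (s starts-as o) x → NonLosingStrategy (s starts-as o′) x → o′ ≡ o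
  nonLosing-order≡winning-order first  first  _ _ = refl
  nonLosing-order≡winning-order first  second w n =
    contradiction n (winning-excludes-nonLosing em (_ starts-as first) w)
  nonLosing-order≡winning-order second first  w n =
    contradiction n (winning-excludes-nonLosing em (_ starts-as second) w)
  nonLosing-order≡winning-order second second _ _ = refl

  nonLosing-component : ∀ p → HasNonLosing p x →
                        ∀ s → NonLosingStrategy (s starts-as orderOf p s) x
  nonLosing-component p = components NonLosing p

  hasWinning⇒hasNonLosing : ∀ p → HasWinning p x → HasNonLosing p x
  hasWinning⇒hasNonLosing p w =
    assemble NonLosing p λ s → winning⇒nonLosing (components Winning p w s)

  nonLosing-player≡winning-player : ∀ p q → HasWinning p x → HasNonLosing q x → q ≡ p
  nonLosing-player≡winning-player p q w n =
    trans (sym (playerWith-orderOf q))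
      (trans (cong₂ playerWith (same Left) (same Right)) (playerWith-orderOf p))
    where
    same : ∀ s → orderOf q s ≡ orderOf p s
    same s = nonLosing-order≡winning-order _ _
      (components Winning p w s) (nonLosing-component q n s)

  Conclusion : Set (suc ℓ)
  Conclusion =
    (ExactlyOneWins x ⊎ AtLeastTwoNonLosing x) ×
    (AtLeastTwoNonLosing x →
      (ExactlyOneOf (HasNonLosing L x) (HasNonLosing R x) ×
       ExactlyOneOf (HasNonLosing I x) (HasNonLosing II x))
      ⊎ (∀ p → HasNonLosing p x))

  both-starters-won : ∀ p → HasWinning p x → Conclusion
  both-starters-won p w =
    inj₁ (p , w ,
      (λ q w′ → unique q (hasWinning⇒hasNonLosing q w′)) ,
      (λ q q≢p n → q≢p (unique q n))) ,
    λ (q , q′ , q≢q′ , n , n′) → contradiction (trans (unique q n) (sym (unique q′ n′))) q≢q′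
    where
    unique : ∀ q → HasNonLosing q x → q ≡ p
    unique q = nonLosing-player≡winning-player p q w

  no-starter-won : (∀ s o → NonLosingStrategy (s starts-as o) x) → Conclusion
  no-starter-won n = inj₂ (L , R , (λ ()) , all L , all R) , λ _ → inj₂ all
    where
    all : ∀ p → HasNonLosing p x
    all p = assemble NonLosing p λ s → n s (orderOf p s)

  -- When just the side s gives a won role, of order o, the players with a
  -- non-losing strategy are those of order o in the games started by s.
  module OneStarterWon {s : Side} (o : Order)
    (w : WinningStrategy (s starts-as o) x)
    (n : ∀ o′ → NonLosingStrategy (opposite s starts-as o′) x) where

    good : ∀ p → orderOf p s ≡ o → HasNonLosing p x
    good p refl = assemble NonLosing p (component s w n)
      where
      component : ∀ s → WinningStrategy (s starts-as orderOf p s) x →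
                  (∀ o′ → NonLosingStrategy (opposite s starts-as o′) x) →
                  ∀ s′ → NonLosingStrategy (s′ starts-as orderOf p s′) x
      component Left  w n Left  = winning⇒nonLosing w
      component Left  w n Right = n _
      component Right w n Left  = n _
      component Right w n Right = winning⇒nonLosing w

    good-order : ∀ p → HasNonLosing p x → orderOf p s ≡ o
    good-order p h = nonLosing-order≡winning-order o _ w (nonLosing-component p h s)

    exactlyOne : ∀ p q → orderOf p s ≢ orderOf q s →
                 orderOf p s ≡ o ⊎ orderOf q s ≡ o →
                 ExactlyOneOf (HasNonLosing p x) (HasNonLosing q x)
    exactlyOne p q p≢q one =
      Sum.map (good p) (good q) one ,
      λ (h , h′) → p≢q (trans (good-order p h) (sym (good-order q h′)))

    conclusion : ∀ p q → p ≢ q → orderOf p s ≡ o → orderOf q s ≡ o →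
                 orderOf L s ≢ orderOf R s → orderOf L s ≡ o ⊎ orderOf R s ≡ o →
                 orderOf I s ≡ o ⊎ orderOf II s ≡ o → Conclusion
    conclusion p q p≢q p≡ q≡ L≢R LR I-II =
      inj₂ (p , q , p≢q , good p p≡ , good q q≡) ,
      λ _ → inj₁ (exactlyOne L R L≢R LR , exactlyOne I II (λ ()) I-II)

  one-starter-won : ∀ s o → WinningStrategy (s starts-as o) x →
                    (∀ o′ → NonLosingStrategy (opposite s starts-as o′) x) → Conclusion
  one-starter-won Left first w n = OneStarterWon.conclusion first w n
    L I (λ ()) refl refl (λ ()) (inj₁ refl) (inj₁ refl)
  one-starter-won Left second w n = OneStarterWon.conclusion second w n
    R II (λ ()) refl refl (λ ()) (inj₂ refl) (inj₂ refl)
  one-starter-won Right first w n = OneStarterWon.conclusion first w n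
    R I (λ ()) refl refl (λ ()) (inj₂ refl) (inj₁ refl)
  one-starter-won Right second w n = OneStarterWon.conclusion second w n
    L II (λ ()) refl refl (λ ()) (inj₁ refl) (inj₂ refl)

  conclusion : Conclusion
  conclusion with starter-value Left | starter-value Right
  ... | inj₁ (o , w) | inj₁ (o′ , w′) = both-starters-won (playerWith o o′)
    (assemble Winning (playerWith o o′)
      (orderOf-playerWith (λ s o → WinningStrategy (s starts-as o) x) o o′ w w′))
  ... | inj₁ (o , w) | inj₂ n         = one-starter-won Left o w n
  ... | inj₂ n       | inj₁ (o , w)   = one-starter-won Right o w n
  ... | inj₂ n       | inj₂ n′        = no-starter-won λ { Left → n ; Right → n′ }

theorem2p14 : {ℓ : Level} → ExcludedMiddle (suc ℓ) → AxiomOfChoice ℓ →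
    (x : Hypergame ℓ) →
    (ExactlyOneWins x ⊎ AtLeastTwoNonLosing x) ×
    (AtLeastTwoNonLosing x →
    (ExactlyOneOf (HasNonLosing L x) (HasNonLosing R x) ×
    ExactlyOneOf (HasNonLosing I x) (HasNonLosing II x))
    ⊎ (∀ p → HasNonLosing p x))
theorem2p14 em choice x = Table.conclusion em choice x
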